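{- Let $K\subseteq\mathbb{R}^d$ be a convex body, $\Lambda\subseteq\mathbb{R}^d$ a lattice with basis $\{f_1,\dots,f_d\}$, and $i\in\{1,\dots,d\}$. For each $i$-element subset $I\subseteq\{1,\dots,d\}$ let $L_I=\operatorname{span}_{\mathbb{R}}\{f_k: k\in I\}$. If $\dim(K\cap L_I)=i$ for every $i$-element subset $I$, then $$\mu_i(K,\Lambda)\leqslant\max\Big\{\mu(K\cap L_I,\Lambda\cap L_I): I\subseteq\{1,\dots,d\},\ |I|=i\Big\}.$$
   Context: A convex body is a full-dimensional compact convex set; a lattice is a full-rank discrete subgroup. For a convex body $K\subseteq\mathbb{R}^d$ and $i\in\{1,\dots,d\}$, $\mu_i(K,\Lambda)=\min\{\mu\ge0: (\mu K+\Lambda)\cap U\ne\emptyset$ for every $(d-i)$-dimensional affine subspace $U\subseteq\mathbb{R}^d\}$. For a $k$-dimensional real vector space $E$, a lattice $\Gamma\subseteq E$ and a convex body $C\subseteq E$, the covering radius is $\mu(C,\Gamma)=\min\{\mu\ge0:\mu C+\Gamma=E\}$; here $\mu(K\cap L_I,\Lambda\cap L_I)$ is computed inside $L_I$. -}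

module Defs where

open import Algebra.Bundles using (CommutativeRing)
open import Data.Fin.Base using (Fin)
open import Data.Fin.Subset using (Subset) renaming (_∈_ to _∈ₛ_)
open import Data.Integer.Base using (ℤ; +_; -[1+_])
open import Data.List.Relation.Unary.Any using (Any)
open import Data.Nat.Base using (ℕ; suc; _∸_)
open import Data.Product.Base using (∃; ∃-syntax; _×_)
open import Data.Vec.Functional using (Vector)
open import Level using (0ℓ)
open import Relation.Binary.Core using (Rel)
open import Relation.Binary.Definitions using (_Respects_)
open import Relation.Binary.Structures using (IsTotalOrder)
open import Relation.Nullary.Negation.Core using (¬_)
open import Relation.Unary using (Pred; _∈_; _⊆_; _≐_; _∩_; Satisfiable)

-- ℝ enters axiomatically, as a Dedekind-complete ordered field; classically
-- these axioms determine it up to isomorphism.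
record CompleteOrderedField : Set₁ where
  field
    commutativeRing : CommutativeRing 0ℓ 0ℓ

  open CommutativeRing commutativeRing public

  infix 4 _≤_ _<_

  field
    _≤_          : Rel Carrier 0ℓ
    isTotalOrder : IsTotalOrder _≈_ _≤_
    1≉0          : ¬ (1# ≈ 0#)
    inverse      : ∀ x → ¬ (x ≈ 0#) → ∃[ y ] x * y ≈ 1#
    +-monoˡ-≤    : ∀ {x y} z → x ≤ y → x + z ≤ y + z
    *-nonNeg     : ∀ {x y} → 0# ≤ x → 0# ≤ y → 0# ≤ x * y
    supremum     : (P : Pred Carrier 0ℓ) → Satisfiable P →
                   (∃[ b ] (∀ x → x ∈ P → x ≤ b)) →
                   ∃[ s ] (∀ x → x ∈ P → x ≤ s) ×
                          (∀ b → (∀ x → x ∈ P → x ≤ b) → s ≤ b)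

  _<_ : Rel Carrier 0ℓ
  x < y = x ≤ y × ¬ (x ≈ y)

module Euclidean (R : CompleteOrderedField) where

  open CompleteOrderedField R
    renaming (Carrier to ℝ; setoid to ℝ-setoid)
  open import Algebra.Properties.CommutativeMonoid.Sum +-commutativeMonoid
    using (sum)
  open import Algebra.Properties.Monoid.Mult +-monoid using () renaming (_×_ to _·ℕ_)
  open import Data.Vec.Functional.Relation.Binary.Equality.Setoid ℝ-setoid
    using (_≋_) public

  IsMinimum : ∀ {ℓ} → Pred ℝ ℓ → ℝ → Set ℓ
  IsMinimum P m = m ∈ P × (∀ x → x ∈ P → m ≤ x)

  IsMaximum : ∀ {ℓ} → Pred ℝ ℓ → ℝ → Set ℓ
  IsMaximum P m = m ∈ P × (∀ x → x ∈ P → x ≤ m)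

  fromℤ : ℤ → ℝ
  fromℤ (+ n)    = n ·ℕ 1#
  fromℤ -[1+ n ] = - (suc n ·ℕ 1#)

  ℝ^_ : ℕ → Set
  ℝ^ d = Vector ℝ d

  PointSet : ℕ → Set₁
  PointSet d = Pred (ℝ^ d) 0ℓ

  module _ {d : ℕ} where

    infixl 6 _+ᵥ_ _-ᵥ_ _⊕_
    infixr 7 _*ᵥ_ _⊙_

    0ᵥ : ℝ^ d
    0ᵥ k = 0#

    _+ᵥ_ _-ᵥ_ : ℝ^ d → ℝ^ d → ℝ^ d
    (x +ᵥ y) k = x k + y k
    (x -ᵥ y) k = x k - y k

    _*ᵥ_ : ℝ → ℝ^ d → ℝ^ d
    (a *ᵥ x) k = a * x k

    lincomb : ∀ {n} → Vector ℝ n → Vector (ℝ^ d) n → ℝ^ d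
    lincomb c v k = sum (λ j → c j * v j k)

    _⊙_ : ℝ → PointSet d → PointSet d
    (a ⊙ A) x = ∃[ y ] y ∈ A × x ≋ a *ᵥ y

    _⊕_ : PointSet d → PointSet d → PointSet d
    (A ⊕ B) x = ∃[ a ] ∃[ b ] a ∈ A × b ∈ B × x ≋ a +ᵥ b

    Span : PointSet d → PointSet d
    Span A x = ∃[ n ] ∃[ c ] ∃[ v ]
      (∀ (j : Fin n) → v j ∈ A) × x ≋ lincomb c v

    AffineHull : PointSet d → PointSet d
    AffineHull A x = ∃[ n ] ∃[ c ] ∃[ v ]
      (∀ (j : Fin n) → v j ∈ A) × sum c ≈ 1# × x ≋ lincomb c v

    LinearlyIndependent : ∀ {n} → Vector (ℝ^ d) n → Set
    LinearlyIndependent v = ∀ c → lincomb c v ≋ 0ᵥ → ∀ j → c j ≈ 0#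

    IsAffineSubspace : ℕ → PointSet d → Set
    IsAffineSubspace k U = ∃[ p ] ∃[ v ] LinearlyIndependent {k} v ×
      (U ≐ λ x → ∃[ c ] x ≋ p +ᵥ lincomb c v)

    -- dim A = k, the dimension being that of the affine hull.
    HasDimension : PointSet d → ℕ → Set
    HasDimension A k = IsAffineSubspace k (AffineHull A)

    dist² : ℝ^ d → ℝ^ d → ℝ
    dist² x y = sum (λ k → (x k - y k) * (x k - y k))

    Ball : ℝ^ d → ℝ → PointSet d
    Ball x ε y = dist² x y < ε * ε

    IsOpen : PointSet d → Set
    IsOpen O = ∀ x → x ∈ O → ∃[ ε ] 0# < ε × Ball x ε ⊆ O

    IsCompact : PointSet d → Set₁
    IsCompact A = (J : Set) (O : J → PointSet d) → (∀ j → IsOpen (O j)) →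
      (∀ x → x ∈ A → ∃[ j ] x ∈ O j) →
      ∃[ js ] (∀ x → x ∈ A → Any (λ j → x ∈ O j) js)

    IsConvex : PointSet d → Set
    IsConvex A = ∀ x y t → x ∈ A → y ∈ A → 0# ≤ t → t ≤ 1# →
      (1# - t) *ᵥ x +ᵥ t *ᵥ y ∈ A

    record IsConvexBody (K : PointSet d) : Set₁ where
      field
        -- Predicates on a setoid denote sets only if they respect equality.
        respects        : K Respects _≋_
        convex          : IsConvex K
        compact         : IsCompact K
        fullDimensional : HasDimension K d

    record IsLattice (Λ : PointSet d) : Set where
      field
        respects  : Λ Respects _≋_
        0∈        : 0ᵥ ∈ Λ
        -closed   : ∀ x y → x ∈ Λ → y ∈ Λ → x -ᵥ y ∈ Λ
        discrete  : ∀ x → x ∈ Λ →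
                    ∃[ ε ] 0# < ε × (∀ y → y ∈ Λ → y ∈ Ball x ε → y ≋ x)
        fullRank  : ∀ x → x ∈ Span Λ

    IsLatticeBasis : PointSet d → Vector (ℝ^ d) d → Set
    IsLatticeBasis Λ f = LinearlyIndependent f ×
      (Λ ≐ λ x → ∃ λ (z : Vector ℤ d) → x ≋ lincomb (λ k → fromℤ (z k)) f)

    -- L_I, for a family f and I ⊆ {1,…,d}.
    CoordinateSubspace : Vector (ℝ^ d) d → Subset d → PointSet d
    CoordinateSubspace f I = Span (λ v → ∃[ k ] k ∈ₛ I × v ≋ f k)

    -- m = μ_i(K,Λ)
    IsCoveringMinimum : ℕ → PointSet d → PointSet d → ℝ → Set₁
    IsCoveringMinimum i K Λ = IsMinimum λ μ → 0# ≤ μ ×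
      (∀ U → IsAffineSubspace (d ∸ i) U → Satisfiable (((μ ⊙ K) ⊕ Λ) ∩ U))

    -- m = μ(C,Γ), computed inside the linear subspace E.
    IsCoveringRadius : PointSet d → PointSet d → PointSet d → ℝ → Set
    IsCoveringRadius E C Γ = IsMinimum λ μ → 0# ≤ μ × ((μ ⊙ C) ⊕ Γ ≐ E)

{-# OPTIONS --safe #-}

-- Let U = p + W with dim W = d − i.  By Steinitz exchange some coordinate
-- subspace L_I with |I| = i satisfies W + L_I = ℝ^d, so every translate of U
-- meets L_I, where μ_I (K ∩ L_I) + (Λ ∩ L_I) covers everything.  With M the
-- largest of the μ_J and c ∈ K ∩ L_I, convexity gives
-- μ_I K + (M − μ_I) c ⊆ M K; applying the covering of L_I to the translate
-- U − (M − μ_I) c yields a point of U in M K + Λ.  (The translation is needed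
-- because K need not contain the origin.)

module Submission where

open import Defs
open import Axiom.ExcludedMiddle using (ExcludedMiddle)
open import Data.Empty using (⊥-elim)
open import Data.Fin.Base using (Fin; zero; suc)
open import Data.Fin.Properties using (¬∀⟶∃¬) renaming (_≟_ to _≟F_)
open import Data.Fin.Subset using (Subset; ∣_∣; inside; outside; ⊥; ⊤; _-_) renaming (_∈_ to _∈ₛ_; _∉_ to _∉ₛ_)
open import Data.Fin.Subset.Properties using (_∈?_; ∈⊤; ∣⊤∣≡n; ∣⊥∣≡0; p─⊥≡p; x∈p∧x≢y⇒x∈p-y)
open import Data.Nat.Base as ℕ using (ℕ; suc; z≤n; s≤s)
open import Data.Nat.Properties as ℕₚ using ()
open import Data.Product.Base using (∃; ∃-syntax; _×_; _,_; proj₁; proj₂)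
open import Data.Sum.Base using (_⊎_; inj₁; inj₂)
open import Data.Vec.Base using ([]; _∷_; here; there)
open import Data.Vec.Functional using (Vector; head; tail) renaming (_∷_ to _◂_)
open import Function.Base using (_∘_)
open import Level using (0ℓ)
open import Relation.Binary.PropositionalEquality.Core as ≡ using (_≡_)
open import Relation.Nullary.Decidable.Core using (yes; no)
open import Relation.Nullary.Negation.Core using (¬_; contradiction)
open import Relation.Unary using (Pred; _∈_; _∩_; Satisfiable)

-- Subsets of a finite set: cardinality and maximisation.

subset-of-size : ∀ {m n} → m ℕ.≤ n → ∃ λ (I : Subset n) → ∣ I ∣ ≡ m
subset-of-size {n = n} z≤n = ⊥ , ∣⊥∣≡0 n
subset-of-size (s≤s m≤n) with subset-of-size m≤n
... | I , ∣I∣≡m = inside ∷ I , ≡.cong suc ∣I∣≡m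

x∈p⇒1+∣p-x∣≡∣p∣ : ∀ {n} {x : Fin n} {p} → x ∈ₛ p → suc ∣ p - x ∣ ≡ ∣ p ∣
-- Deleting the head leaves the tail minus the empty set.
x∈p⇒1+∣p-x∣≡∣p∣ {p = inside  ∷ p} here        = ≡.cong (suc ∘ ∣_∣) (p─⊥≡p p)
x∈p⇒1+∣p-x∣≡∣p∣ {p = inside  ∷ p} (there x∈p) = ≡.cong suc (x∈p⇒1+∣p-x∣≡∣p∣ x∈p)
x∈p⇒1+∣p-x∣≡∣p∣ {p = outside ∷ p} (there x∈p) = x∈p⇒1+∣p-x∣≡∣p∣ x∈p

module _ (em : ExcludedMiddle 0ℓ) (R : CompleteOrderedField) where

  open CompleteOrderedField R hiding (zero) renaming (Carrier to ℝ; _-_ to _−_)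
  open Euclidean R
  open import Algebra.Properties.AbelianGroup +-abelianGroup using (⁻¹-anti-homo‿-)
  open import Algebra.Properties.CommutativeSemigroup +-commutativeSemigroup using (x∙yz≈y∙xz; xy∙z≈xz∙y)
  open import Algebra.Properties.Group +-group using (//-rightDividesˡ; ⁻¹-involutive)
  open import Algebra.Properties.Ring ring using (-‿distribˡ-*; -‿distribʳ-*; x[y-z]≈xy-xz; [y-z]x≈yx-zx)
  open import Algebra.Properties.Semiring.Sum semiring using (sum-cong-≋; sum-replicate-zero; ∑-distrib-+; *-distribˡ-sum)
  open import Relation.Binary.Reasoning.Setoid setoid
  open import Relation.Binary.Structures using (IsTotalOrder)
  open IsTotalOrder isTotalOrder
    using (total; antisym; ≤-respˡ-≈; ≤-respʳ-≈) renaming (refl to ≤-refl; trans to ≤-trans)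

  -- Subsets split by whether they contain the first element, and the larger of the two recursive
  -- maxima wins. As `P` is an arbitrary predicate, excluded middle decides which halves contain a
  -- candidate at all.
  argmax : ∀ {n} (P : Pred (Subset n) 0ℓ) (g : Subset n → ℝ) → Satisfiable P →
           ∃[ I ] I ∈ P × (∀ J → J ∈ P → g J ≤ g I)
  argmax {ℕ.zero} P g ([] , P[]) = [] , P[] , λ { [] _ → ≤-refl }
  argmax {suc n} P g (I₀ , PI₀)
    with em {Satisfiable (P ∘ (inside ∷_))} | em {Satisfiable (P ∘ (outside ∷_))}
  ... | no ¬in | no ¬out = ⊥-elim (neither I₀ PI₀)
    where
    neither : ∀ I → ¬ I ∈ P
    neither (inside  ∷ I) PI = ¬in (I , PI)
    neither (outside ∷ I) PI = ¬out (I , PI)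
  ... | yes sat | no ¬out with argmax (P ∘ (inside ∷_)) (g ∘ (inside ∷_)) sat
  ...   | I , PI , max = inside ∷ I , PI ,
          λ { (inside ∷ J) PJ → max J PJ ; (outside ∷ J) PJ → contradiction (J , PJ) ¬out }
  argmax {suc n} P g (I₀ , PI₀) | no ¬in | yes sat
    with argmax (P ∘ (outside ∷_)) (g ∘ (outside ∷_)) sat
  ...   | I , PI , max = outside ∷ I , PI ,
          λ { (outside ∷ J) PJ → max J PJ ; (inside ∷ J) PJ → contradiction (J , PJ) ¬in }
  argmax {suc n} P g (I₀ , PI₀) | yes sat₁ | yes sat₂
    with argmax (P ∘ (inside ∷_)) (g ∘ (inside ∷_)) sat₁
       | argmax (P ∘ (outside ∷_)) (g ∘ (outside ∷_)) sat₂
  ... | I , PI , max₁ | J , PJ , max₂ with total (g (inside ∷ I)) (g (outside ∷ J))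
  ...   | inj₁ I≤J = outside ∷ J , PJ ,
          λ { (inside ∷ H) PH → ≤-trans (max₁ H PH) I≤J ; (outside ∷ H) PH → max₂ H PH }
  ...   | inj₂ J≤I = inside ∷ I , PI ,
          λ { (inside ∷ H) PH → max₁ H PH ; (outside ∷ H) PH → ≤-trans (max₂ H PH) J≤I }

  -- Ordered field arithmetic.

  x≤y⇒0≤y−x : ∀ {x y} → x ≤ y → 0# ≤ y − x
  x≤y⇒0≤y−x {x} x≤y = ≤-respˡ-≈ (-‿inverseʳ x) (+-monoˡ-≤ (- x) x≤y)

  0≤y−x⇒x≤y : ∀ {x y} → 0# ≤ y − x → x ≤ y
  0≤y−x⇒x≤y {x} {y} 0≤y−x =
    ≤-respˡ-≈ (+-identityˡ x) (≤-respʳ-≈ (//-rightDividesˡ x y) (+-monoˡ-≤ x 0≤y−x))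

  x≤0⇒0≤-x : ∀ {x} → x ≤ 0# → 0# ≤ - x
  x≤0⇒0≤-x x≤0 = ≤-respʳ-≈ (+-identityˡ _) (x≤y⇒0≤y−x x≤0)

  -- If 1 ≤ 0 then -1 is nonnegative, hence so is its square 1, and antisymmetry forces 1 = 0.
  1≰0 : ¬ (1# ≤ 0#)
  1≰0 1≤0 = 1≉0 (antisym 1≤0 (≤-respʳ-≈ [-1]²≈1 (*-nonNeg 0≤-1 0≤-1)))
    where
    0≤-1 = x≤0⇒0≤-x 1≤0
    [-1]²≈1 : - 1# * - 1# ≈ 1#
    [-1]²≈1 = begin
      - 1# * - 1#    ≈⟨ -‿distribˡ-* 1# (- 1#) ⟨
      - (1# * - 1#)  ≈⟨ -‿cong (*-identityˡ (- 1#)) ⟩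
      - - 1#         ≈⟨ ⁻¹-involutive 1# ⟩
      1#             ∎

  -- Were `y` nonpositive, `x * - y` = -1 would be a product of nonnegative factors.
  inverse-nonNeg : ∀ {x y} → 0# ≤ x → x * y ≈ 1# → 0# ≤ y
  inverse-nonNeg {x} {y} 0≤x xy≈1 with total 0# y
  ... | inj₁ 0≤y = 0≤y
  ... | inj₂ y≤0 = contradiction (0≤y−x⇒x≤y (≤-respʳ-≈ x[-y]≈0−1 (*-nonNeg 0≤x (x≤0⇒0≤-x y≤0)))) 1≰0
    where
    x[-y]≈0−1 : x * - y ≈ 0# − 1#
    x[-y]≈0−1 = begin
      x * - y    ≈⟨ -‿distribʳ-* x y ⟨
      - (x * y)  ≈⟨ -‿cong xy≈1 ⟩
      - 1#       ≈⟨ +-identityˡ (- 1#) ⟨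
      0# − 1#    ∎

  x−[x−y]≈y : ∀ x y → x − (x − y) ≈ y
  x−[x−y]≈y x y = begin
    x − (x − y)  ≈⟨ +-congˡ (⁻¹-anti-homo‿- x y) ⟩
    x + (y − x)  ≈⟨ +-comm x (y − x) ⟩
    y − x + x    ≈⟨ //-rightDividesˡ x y ⟩
    y            ∎

  module _ {d : ℕ} where

    -- Linear combinations and spans.

    lincomb-zeroˡ : ∀ {n} {c : Vector ℝ n} (v : Vector (ℝ^ d) n) →
                    (∀ j → c j ≈ 0#) → lincomb c v ≋ 0ᵥ
    lincomb-zeroˡ {n} v c≈0 k =
      trans (sum-cong-≋ (λ j → trans (*-congʳ (c≈0 j)) (zeroˡ (v j k)))) (sum-replicate-zero n)

    lincomb-+* : ∀ {n} (a b : Vector ℝ n) t (v : Vector (ℝ^ d) n) →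
                 lincomb (λ j → a j + t * b j) v ≋ lincomb a v +ᵥ t *ᵥ lincomb b v
    lincomb-+* a b t v k = begin
      lincomb (λ j → a j + t * b j) v k  ≈⟨ sum-cong-≋ (λ j → trans (distribʳ (v j k) (a j) (t * b j)) (+-congˡ (*-assoc t (b j) (v j k)))) ⟩
      _                                  ≈⟨ ∑-distrib-+ (λ j → a j * v j k) (λ j → t * (b j * v j k)) ⟩
      _                                  ≈⟨ +-congˡ (*-distribˡ-sum t (λ j → b j * v j k)) ⟨
      lincomb a v k + t * lincomb b v k  ∎

    Generates : ∀ {n} → Vector (ℝ^ d) n → Set
    Generates f = ∀ x → ∃[ e ] x ≋ lincomb e f

    lincomb-lincomb : ∀ {m n} {f : Vector (ℝ^ d) n} (c : Vector ℝ m) {v : Vector (ℝ^ d) m} →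
                      (∀ j → ∃[ e ] v j ≋ lincomb e f) → ∃[ e ] lincomb c v ≋ lincomb e f
    lincomb-lincomb {ℕ.zero} {f = f} c h =
      (λ _ → 0#) , λ k → sym (lincomb-zeroˡ f (λ _ → refl) k)
    lincomb-lincomb {suc m} {f = f} c {v} h with h zero | lincomb-lincomb (tail c) (h ∘ suc)
    ... | e₀ , v₀≋ | e , eq = (λ l → e l + c zero * e₀ l) , λ k → begin
      c zero * v zero k + lincomb (tail c) (tail v) k  ≈⟨ +-comm _ _ ⟩
      lincomb (tail c) (tail v) k + c zero * v zero k  ≈⟨ +-cong (eq k) (*-congˡ (v₀≋ k)) ⟩
      lincomb e f k + c zero * lincomb e₀ f k          ≈⟨ lincomb-+* e e₀ (c zero) f k ⟨
      lincomb (λ l → e l + c zero * e₀ l) f k          ∎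

    -- Full rank writes `x` as a real combination of lattice vectors, each of which is an integer
    -- combination of `f`; substituting gives coefficients over `f`.
    latticeBasis⇒generates : ∀ {Λ f} → IsLattice Λ → IsLatticeBasis Λ f → Generates f
    latticeBasis⇒generates lat (_ , Λ⊆ , _) x with IsLattice.fullRank lat x
    ... | n , c , v , v∈Λ , x≋ with lincomb-lincomb c (λ j → (λ k → fromℤ (proj₁ (Λ⊆ (v∈Λ j)) k)) , proj₂ (Λ⊆ (v∈Λ j)))
    ...   | e , eq = e , λ k → trans (x≋ k) (eq k)

    -- Terms with coefficient zero are dropped, since `Span` requires every listed vector to lie in
    -- `A`. This lets a combination of the whole basis, supported on `I`, count as a point of the
    -- coordinate subspace.
    lincomb∈Span : ∀ {n} (A : PointSet d) (e : Vector ℝ n) (v : Vector (ℝ^ d) n) →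
                   (∀ j → v j ∈ A ⊎ e j ≈ 0#) → lincomb e v ∈ Span A
    lincomb∈Span {ℕ.zero} A e v h = 0 , e , v , (λ ()) , λ _ → refl
    lincomb∈Span {suc n} A e v h with h zero | lincomb∈Span A (tail e) (tail v) (h ∘ suc)
    ... | inj₁ v₀∈A | m , c , w , w∈A , eq =
      suc m , head e ◂ c , head v ◂ w , (λ { zero → v₀∈A ; (suc j) → w∈A j }) , λ k → +-congˡ (eq k)
    ... | inj₂ e₀≈0 | m , c , w , w∈A , eq = m , c , w , w∈A , λ k → begin
      e zero * v zero k + lincomb (tail e) (tail v) k  ≈⟨ +-congʳ (trans (*-congʳ e₀≈0) (zeroˡ _)) ⟩
      0# + lincomb (tail e) (tail v) k                 ≈⟨ +-identityˡ _ ⟩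
      lincomb (tail e) (tail v) k                      ≈⟨ eq k ⟩
      lincomb c w k                                    ∎

    supported⇒∈CoordinateSubspace :
      ∀ (f : Vector (ℝ^ d) d) I (e : Vector ℝ d) → (∀ j → j ∉ₛ I → e j ≈ 0#) →
      lincomb e f ∈ CoordinateSubspace f I
    supported⇒∈CoordinateSubspace f I e supp =
      lincomb∈Span (λ x → ∃[ k ] k ∈ₛ I × x ≋ f k) e f generator-or-zero
      where
      generator-or-zero : ∀ j → (∃[ k ] k ∈ₛ I × f j ≋ f k) ⊎ e j ≈ 0#
      generator-or-zero j with j ∈? I
      ... | yes j∈I = inj₁ (j , j∈I , λ _ → refl)
      ... | no  j∉I = inj₂ (supp j j∉I)

    -- Steinitz exchange.

    tail-independent : ∀ {n} (v : Vector (ℝ^ d) (suc n)) →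
                       LinearlyIndependent v → LinearlyIndependent (tail v)
    tail-independent v ind c c·v≋0 j =
      ind (0# ◂ c) (λ k → trans (+-cong (zeroˡ (v zero k)) (c·v≋0 k)) (+-identityˡ 0#)) (suc j)

    -- Every translate of the span of v meets the span of {f_j : j ∈ I}.
    Complements : ∀ {m n} → Vector (ℝ^ d) m → Vector (ℝ^ d) n → Subset n → Set
    Complements v f I = ∀ x → ∃[ c ] ∃[ e ] (∀ j → j ∉ₛ I → e j ≈ 0#) × x +ᵥ lincomb c v ≋ lincomb e f

    -- Induction on `m`, starting from the full index set: each further vector of `v` takes over the
    -- role of one `f j`, whose index leaves `I`. The count is stated additively to avoid truncated
    -- subtraction.
    exchange : ∀ {m n} (v : Vector (ℝ^ d) m) → LinearlyIndependent v →
               (f : Vector (ℝ^ d) n) → Generates f →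
               ∃[ I ] ∣ I ∣ ℕ.+ m ≡ n × Complements v f I
    exchange {ℕ.zero} {n} v ind f gen =
      ⊤ , ≡.trans (ℕₚ.+-identityʳ _) (∣⊤∣≡n n) , λ x → let e , x≋ = gen x in
        (λ ()) , e , (λ j j∉⊤ → contradiction ∈⊤ j∉⊤) , λ k → trans (+-identityʳ (x k)) (x≋ k)
    exchange {suc m} {n} v ind f gen with exchange (tail v) (tail-independent v ind) f gen
    ... | I , ∣I∣+m≡n , compl with compl (head v)
    ...   | c , e , e-supp , v₀+c·v≋e·f =
      I - j , ≡.trans (ℕₚ.+-suc _ m) (≡.trans (≡.cong (ℕ._+ m) (x∈p⇒1+∣p-x∣≡∣p∣ j∈I)) ∣I∣+m≡n) , compl′
      where
      -- If `e` vanished, the coefficients 1 and `c` would be a nontrivial relation among the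
      -- vectors of `v`.
      not-all-zero : ¬ (∀ j → e j ≈ 0#)
      not-all-zero e≈0 = 1≉0 (ind (1# ◂ c) dependence zero)
        where
        dependence : lincomb (1# ◂ c) v ≋ 0ᵥ
        dependence k = begin
          1# * v zero k + lincomb c (tail v) k  ≈⟨ +-congʳ (*-identityˡ _) ⟩
          v zero k + lincomb c (tail v) k       ≈⟨ v₀+c·v≋e·f k ⟩
          lincomb e f k                         ≈⟨ lincomb-zeroˡ f e≈0 k ⟩
          0#                                    ∎

      pivot : ∃[ j ] ¬ (e j ≈ 0#)
      pivot = ¬∀⟶∃¬ n _ (λ _ → em) not-all-zero

      j = proj₁ pivot

      j∈I : j ∈ₛ I
      j∈I with j ∈? I
      ... | yes j∈I = j∈I
      ... | no  j∉I = contradiction (e-supp j j∉I) (proj₂ pivot)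

      compl′ : Complements v f (I - j)
      compl′ x with compl x | inverse (e j) (proj₂ pivot)
      ... | c′ , e′ , e′-supp , x+c′·v≋e′·f | y , eⱼy≈1 =
        -- The relation expressing `head v` is added `t` times to the one for `x`. As `y` inverts
        -- `e j`, the choice `t` = -(`e′ j` / `e j`) eliminates the index `j`.
        t ◂ (λ l → c′ l + t * c l) , (λ l → e′ l + t * e l) , supp , eq
        where
        t = - (e′ j * y)

        cancels : e′ j + t * e j ≈ 0#
        cancels = begin
          e′ j + - (e′ j * y) * e j  ≈⟨ +-congˡ (-‿distribˡ-* (e′ j * y) (e j)) ⟨
          e′ j − e′ j * y * e j      ≈⟨ +-congˡ (-‿cong (*-assoc (e′ j) y (e j))) ⟩
          e′ j − e′ j * (y * e j)    ≈⟨ +-congˡ (-‿cong (*-congˡ (trans (*-comm y (e j)) eⱼy≈1))) ⟩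
          e′ j − e′ j * 1#           ≈⟨ +-congˡ (-‿cong (*-identityʳ (e′ j))) ⟩
          e′ j − e′ j                ≈⟨ -‿inverseʳ (e′ j) ⟩
          0#                         ∎

        supp : ∀ l → l ∉ₛ I - j → e′ l + t * e l ≈ 0#
        supp l l∉I-j with l ≟F j
        ... | yes ≡.refl = cancels
        ... | no  l≢j    = begin
          e′ l + t * e l  ≈⟨ +-cong (e′-supp l l∉I) (*-congˡ (e-supp l l∉I)) ⟩
          0# + t * 0#     ≈⟨ trans (+-identityˡ _) (zeroʳ t) ⟩
          0#              ∎
          where
          l∉I : l ∉ₛ I
          l∉I l∈I = l∉I-j (x∈p∧x≢y⇒x∈p-y l∈I l≢j)

        eq : x +ᵥ lincomb (t ◂ (λ l → c′ l + t * c l)) v ≋ lincomb (λ l → e′ l + t * e l) f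
        eq k = begin
          x k + (t * v zero k + lincomb (λ l → c′ l + t * c l) (tail v) k)
            ≈⟨ +-congˡ (+-congˡ (lincomb-+* c′ c t (tail v) k)) ⟩
          x k + (t * v zero k + (lincomb c′ (tail v) k + t * lincomb c (tail v) k))
            ≈⟨ +-congˡ (x∙yz≈y∙xz _ _ _) ⟩
          x k + (lincomb c′ (tail v) k + (t * v zero k + t * lincomb c (tail v) k))
            ≈⟨ +-assoc _ _ _ ⟨
          (x k + lincomb c′ (tail v) k) + (t * v zero k + t * lincomb c (tail v) k)
            ≈⟨ +-congˡ (distribˡ t _ _) ⟨
          (x k + lincomb c′ (tail v) k) + t * (v zero k + lincomb c (tail v) k)
            ≈⟨ +-cong (x+c′·v≋e′·f k) (*-congˡ (v₀+c·v≋e·f k)) ⟩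
          lincomb e′ f k + t * lincomb e f k
            ≈⟨ lincomb-+* e′ e t f k ⟨
          lincomb (λ l → e′ l + t * e l) f k ∎

    -- Convexity and the covering of a translate.

    hasDimension⇒nonempty : ∀ {A : PointSet d} {n} → HasDimension A n → Satisfiable A
    hasDimension⇒nonempty (p , v , _ , _ , ⊇)
      with ⊇ {p +ᵥ lincomb (λ _ → 0#) v} ((λ _ → 0#) , λ _ → refl)
    -- The base point of the affine hull is an affine combination of points of `A`; it cannot be the
    -- empty one, whose coefficients sum to 0 instead of 1.
    ... | ℕ.zero , c , w , w∈A , 0≈1 , _ = contradiction (sym 0≈1) 1≉0
    ... | suc _  , c , w , w∈A , _       = w zero , w∈A zero

    -- For nonzero `M`, dividing the right-hand side by `M` gives a convex combination of `a` and
    -- `c`, with weights μ/M and 1 - μ/M.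
    convex⇒rescale : ∀ {K : PointSet d} → IsConvex K → ∀ {μ M a c} → 0# ≤ μ → μ ≤ M →
                     a ∈ K → c ∈ K →
                     ∃[ b ] b ∈ K × M *ᵥ b ≋ μ *ᵥ a +ᵥ (M − μ) *ᵥ c
    convex⇒rescale convex {μ} {M} {a} {c} 0≤μ μ≤M a∈K c∈K with em {M ≈ 0#}
    -- Here 0 ≤ μ ≤ M = 0, so both scalings vanish and `a` itself serves.
    ... | yes M≈0 = a , a∈K , λ k → begin
      M * a k                    ≈⟨ *-congʳ M≈μ ⟩
      μ * a k                    ≈⟨ +-identityʳ _ ⟨
      μ * a k + 0#               ≈⟨ +-congˡ (zeroˡ (c k)) ⟨
      μ * a k + 0# * c k         ≈⟨ +-congˡ (*-congʳ (trans (+-congʳ M≈μ) (-‿inverseʳ μ))) ⟨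
      μ * a k + (M − μ) * c k    ∎
      where
      M≈μ : M ≈ μ
      M≈μ = antisym (≤-respˡ-≈ (sym M≈0) 0≤μ) μ≤M
    ... | no M≉0 with inverse M M≉0
    ...   | y , My≈1 = (1# − t) *ᵥ a +ᵥ t *ᵥ c , convex a c t a∈K c∈K 0≤t t≤1 , λ k → begin
      M * ((1# − t) * a k + t * c k)          ≈⟨ distribˡ M _ _ ⟩
      M * ((1# − t) * a k) + M * (t * c k)    ≈⟨ +-cong (*-assoc M _ _) (*-assoc M _ _) ⟨
      M * (1# − t) * a k + M * t * c k        ≈⟨ +-cong (*-congʳ M[1−t]≈μ) (*-congʳ Mt≈M−μ) ⟩
      μ * a k + (M − μ) * c k                 ∎
      where
      t = (M − μ) * y

      0≤y : 0# ≤ y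
      0≤y = inverse-nonNeg (≤-trans 0≤μ μ≤M) My≈1

      0≤t : 0# ≤ t
      0≤t = *-nonNeg (x≤y⇒0≤y−x μ≤M) 0≤y

      μy≈1−t : μ * y ≈ 1# − t
      μy≈1−t = begin
        μ * y                ≈⟨ x−[x−y]≈y 1# (μ * y) ⟨
        1# − (1# − μ * y)    ≈⟨ +-congˡ (-‿cong (+-congʳ My≈1)) ⟨
        1# − (M * y − μ * y) ≈⟨ +-congˡ (-‿cong ([y-z]x≈yx-zx y M μ)) ⟨
        1# − t               ∎

      t≤1 : t ≤ 1#
      t≤1 = 0≤y−x⇒x≤y (≤-respʳ-≈ μy≈1−t (*-nonNeg 0≤μ 0≤y))

      Mt≈M−μ : M * t ≈ M − μ
      Mt≈M−μ = begin
        M * ((M − μ) * y)  ≈⟨ *-comm M _ ⟩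
        (M − μ) * y * M    ≈⟨ *-assoc (M − μ) y M ⟩
        (M − μ) * (y * M)  ≈⟨ *-congˡ (trans (*-comm y M) My≈1) ⟩
        (M − μ) * 1#       ≈⟨ *-identityʳ _ ⟩
        M − μ              ∎

      M[1−t]≈μ : M * (1# − t) ≈ μ
      M[1−t]≈μ = begin
        M * (1# − t)    ≈⟨ x[y-z]≈xy-xz M 1# t ⟩
        M * 1# − M * t  ≈⟨ +-cong (*-identityʳ M) (-‿cong Mt≈M−μ) ⟩
        M − (M − μ)     ≈⟨ x−[x−y]≈y M μ ⟩
        μ               ∎

    covering-meets-complement :
      ∀ {K Λ : PointSet d} {f : Vector (ℝ^ d) d} {I : Subset d} {m} {v : Vector (ℝ^ d) m} {μ M} →
      let L = CoordinateSubspace f I in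
      IsConvex K → Satisfiable (K ∩ L) → IsCoveringRadius L (K ∩ L) (Λ ∩ L) μ → μ ≤ M →
      Complements v f I → ∀ p → ∃[ b ] p +ᵥ lincomb b v ∈ (M ⊙ K) ⊕ Λ
    covering-meets-complement {f = f} {I} {v = v} {μ} {M} convex (c , c∈K , _) ((0≤μ , _ , L⊆) , _) μ≤M compl p
      with compl (p -ᵥ (M − μ) *ᵥ c)
    ... | b , e , supp , meets with L⊆ (supported⇒∈CoordinateSubspace f I e supp)
    ... | a′ , γ , (a , (a∈K , _) , a′≋μa) , (γ∈Λ , _) , e·f≋a′+γ
      with convex⇒rescale convex 0≤μ μ≤M a∈K c∈K
    ... | q , q∈K , Mq≋ =
      -- The `b` found for the shifted base point also serves for `p`: adding `s` back undoes the
      -- shift, and `Mq≋` absorbs `s` into `M *ᵥ q`.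
      b , M *ᵥ q , γ , (q , q∈K , λ _ → refl) , γ∈Λ , λ k → let s = (M − μ) * c k in begin
        p k + lincomb b v k              ≈⟨ +-congʳ (//-rightDividesˡ s (p k)) ⟨
        p k − s + s + lincomb b v k      ≈⟨ xy∙z≈xz∙y _ _ _ ⟩
        p k − s + lincomb b v k + s      ≈⟨ +-congʳ (trans (meets k) (e·f≋a′+γ k)) ⟩
        a′ k + γ k + s                   ≈⟨ xy∙z≈xz∙y _ _ _ ⟩
        a′ k + s + γ k                   ≈⟨ +-congʳ (+-congʳ (a′≋μa k)) ⟩
        μ * a k + s + γ k                ≈⟨ +-congʳ (Mq≋ k) ⟨
        M * q k + γ k                    ∎

theorem1p3 :
    ExcludedMiddle 0ℓ →
    (R : CompleteOrderedField) →
    let open CompleteOrderedField R renaming (Carrier to ℝ)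
        open Euclidean R in
    (d : ℕ) (K : PointSet d) → IsConvexBody K →
    (Λ : PointSet d) → IsLattice Λ →
    (f : Vector (ℝ^ d) d) → IsLatticeBasis Λ f →
    (i : ℕ) → 1 ℕ.≤ i → i ℕ.≤ d →
    let L : Subset d → PointSet d
        L = CoordinateSubspace f in
    (∀ I → ∣ I ∣ ≡ i → HasDimension (K ∩ L I) i) →
    (μᵢ : ℝ) → IsCoveringMinimum i K Λ μᵢ →
    (μ : Subset d → ℝ) →
    (∀ I → ∣ I ∣ ≡ i → IsCoveringRadius (L I) (K ∩ L I) (Λ ∩ L I) (μ I)) →
    ∃[ M ] IsMaximum (λ x → ∃[ I ] ∣ I ∣ ≡ i × x ≈ μ I) M × μᵢ ≤ M
theorem1p3 em R d K body Λ lat f basis i _ i≤d dim μᵢ (_ , μᵢ-least) μ radius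
  -- The bound `i≤d` makes the family of index sets nonempty, so a maximum exists.
  with argmax em R (λ I → ∣ I ∣ ≡ i) μ (subset-of-size i≤d)
... | I₀ , ∣I₀∣≡i , max =
  μ I₀ ,
  ((I₀ , ∣I₀∣≡i , refl) , λ { x (I , ∣I∣≡i , x≈μI) → ≤-respˡ-≈ (sym x≈μI) (max I ∣I∣≡i) }) ,
  -- By minimality of `μᵢ` it suffices that `μ I₀` is itself admissible: nonnegative, and meeting
  -- every affine subspace of dimension `d ∸ i`.
  μᵢ-least (μ I₀) (proj₁ (proj₁ (radius I₀ ∣I₀∣≡i)) , meets)
  where
  open CompleteOrderedField R using (isTotalOrder; refl; sym)
  open import Relation.Binary.Structures using (IsTotalOrder)
  open IsTotalOrder isTotalOrder using (≤-respˡ-≈)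
  open Euclidean R

  meets : ∀ U → IsAffineSubspace (d ℕ.∸ i) U → Satisfiable (((μ I₀ ⊙ K) ⊕ Λ) ∩ U)
  meets U (p , v , ind , _ , ⊇U)
    -- The set `I` produced here depends on the directions of `U`.
    with exchange em R v ind f (latticeBasis⇒generates em R lat basis)
  ... | I , ∣I∣+[d∸i]≡d , compl
    -- Since `i≤d`, the truncated difference satisfies i + (d ∸ i) = d, so cancelling leaves exactly
    -- `i` indices.
    with ℕₚ.+-cancelʳ-≡ (d ℕ.∸ i) ∣ I ∣ i (≡.trans ∣I∣+[d∸i]≡d (≡.sym (ℕₚ.m+[n∸m]≡n i≤d)))
  -- Maximality gives `μ I` ≤ `μ I₀`, so the single dilation factor `μ I₀` works whichever `I` arose
  -- from `U`.
  ... | ∣I∣≡i with covering-meets-complement em R (IsConvexBody.convex body)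
                     (hasDimension⇒nonempty em R (dim I ∣I∣≡i)) (radius I ∣I∣≡i) (max I ∣I∣≡i) compl p
  ... | b , x∈MK+Λ = p +ᵥ lincomb b v , x∈MK+Λ , ⊇U (b , λ _ → refl)
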